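{- Assume excluded middle. If $\mathrm{GDC}_{\mathbb N,B,T}$ holds for all types $B$ and all $T:\mathcal P((\mathbb N\times B)^*)$, then $\exists\mathrm{MPCF}_{\mathbb N,B,T}$ holds for all types $B$ and all $T:\mathcal P((\mathbb N\times B)^*)$.
   Context: Setting: intuitionistic higher-order arithmetic with inductive types and extensional equality of predicates (here with excluded middle added; no choice principle is assumed). $\mathcal P(A)$ denotes $A\to\mathrm{Prop}$, with $a\in P$ meaning $P(a)$. $A^*$ is the type of finite lists over $A$, $\varepsilon$ the empty list, $u@a$ the list $u$ with $a$ appended at the end; $a\in u$ means $a$ occurs in $u$. For $u:A^*$, $\alpha:\mathcal P(A)$, $u\subset\alpha$ means $\forall a,\ a\in u\to a\in\alpha$; a list $u$ determines the predicate $\langle u\rangle:=\lambda x.\,x\in u$. For $T:\mathcal P(A^*)$, $\langle T\rangle:=\{\alpha:\mathcal P(A)\mid\forall u^{A^*},\ u\subset\alpha\to u\in T\}$. For $P:\mathcal P(\mathcal P(A))$, $\lfloor P\rfloor:=\{u:A^*\mid\langle u\rangle\in P\}$. $B_\bot:=B+\mathbf 1$, with $b:B$ identified with its left injection and $\bot$ the extra element. $\mathrm{GDC}$: let $A,B$ be types and $T:\mathcal P((A\times B)^*)$. For $X:\mathcal P((A\times B)^*)$ put $\phi(X):=\{u\mid u\in\lfloor\langle T\rangle\rfloor\wedge\forall a^A,\ \neg(\exists b^B,\ (a,b)\in u)\to\exists b^B,\ u@(a,b)\in X\}$; $T_{AB\mathrm{ap}}$ is the greatest fixed point of $\phi$.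 $T$ is $A$-$B$-approximable if $\varepsilon\in T_{AB\mathrm{ap}}$. $T$ has an $A$-$B$-choice function if there is $f:A\to B$ such that every $u:(A\times B)^*$ with $u\subset\mathcal G(f)$ is in $T$, where $\mathcal G(f)=\{(a,b)\mid f(a)=b\}$. $\mathrm{GDC}_{A,B,T}$ is: if $T$ is $A$-$B$-approximable then $T$ has an $A$-$B$-choice function. $\exists\mathrm{MPCF}$: for $f:A\to B_\bot$, $\mathrm{dom}(f):=\lambda a.\,f(a)\neq\bot$ and $\mathcal G(f):=\{(a,b):A\times B\mid f(a)=b\}$. For $f,g:A\to B_\bot$, $g\prec f$ means there is $a:A$ with $a\notin\mathrm{dom}(f)$, $\mathrm{dom}(g)=\lambda x.\,(x\in\mathrm{dom}(f)\vee x=a)$, and $f(x)=g(x)$ for all $x\in\mathrm{dom}(f)$. $f\in\mathrm{Max}_{\mathrm{dpf}}(P)$ means $\mathcal G(f)\in P$ and for all $g:A\to B_\bot$, $g\prec f\to\mathcal G(g)\notin P$. For $T:\mathcal P((A\times B)^*)$, $\exists\mathrm{MPCF}_{A,B,T}$ is: $(\exists\alpha^{\mathcal P(A\times B)},\ \alpha\in\langle T\rangle)\to\exists f^{A\to B_\bot},\ f\in\mathrm{Max}_{\mathrm{dpf}}(\langle T\rangle)$. -}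

module Defs where

open import Data.Empty using () renaming (⊥ to Empty)
open import Data.List using (List; []; _∷ʳ_)
open import Data.List.Membership.Propositional using (_∈_)
open import Data.Maybe using (Maybe; just; nothing)
open import Data.Product using (Σ; _×_; _,_)
open import Data.Sum using (_⊎_)
open import Relation.Binary.PropositionalEquality using (_≡_)

-- An impredicative sort Ω of propositions.  Any type can be squashed to a
-- proposition, but a proof of a squashed type can be eliminated only into
-- proofs of propositions.  Reading propositions as types of sort Set would
-- make ∃ a strong sum, so that the axiom of choice would be provable; no choice
-- principle, not even unique choice, is built in here.  Impredicativity is the
-- fact that Ω, hence A → Ω for A : Set, lies in the domain Set of ∥_∥.
record Propositions : Set₁ where
  field
    Ω     : Set
    Pf    : Ω → Set
    ∥_∥   : Set → Ω
    intro : {A : Set} → A → Pf ∥ A ∥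
    elim  : {A : Set} {P : Ω} → (A → Pf P) → Pf ∥ A ∥ → Pf P

module Logic (𝕃 : Propositions) where

  open Propositions 𝕃 public

  infix  8 _≐_ _≗_
  infix  7 ¬_
  infixr 6 _∧_
  infixr 5 _∨_
  infixr 4 _⇒_
  infix  4 _⇔_
  infix  3 All Ex

  _⇒_ _∧_ _∨_ _⇔_ : Ω → Ω → Ω
  P ⇒ Q = ∥ (Pf P → Pf Q) ∥
  P ∧ Q = ∥ Pf P × Pf Q ∥
  P ∨ Q = ∥ Pf P ⊎ Pf Q ∥
  P ⇔ Q = (P ⇒ Q) ∧ (Q ⇒ P)

  ⊥ : Ω
  ⊥ = ∥ Empty ∥

  ¬_ : Ω → Ω
  ¬ P = P ⇒ ⊥

  All Ex : (A : Set) → (A → Ω) → Ω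
  All A P = ∥ (∀ a → Pf (P a)) ∥
  Ex  A P = ∥ (Σ A λ a → Pf (P a)) ∥

  syntax All A (λ a → P) = ∀[ a ∶ A ] P
  syntax Ex  A (λ a → P) = ∃[ a ∶ A ] P

  _≐_ : {A : Set} → A → A → Ω
  x ≐ y = ∥ x ≡ y ∥

  -- Elimination rules of ⇒ and All: these follow from elim because the
  -- conclusion is itself a proof of a proposition.
  ⇒-elim : {P Q : Ω} → Pf (P ⇒ Q) → Pf P → Pf Q
  ⇒-elim h p = elim (λ k → k p) h

  All-elim : {A : Set} {P : A → Ω} → Pf (All A P) → ∀ a → Pf (P a)
  All-elim h a = elim (λ k → k a) h

  ExcludedMiddle : Set
  ExcludedMiddle = (P : Ω) → Pf (P ∨ ¬ P)

  𝒫 : Set → Set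
  𝒫 A = A → Ω

  -- Equality of predicates is extensional.
  _≗_ : {A : Set} → 𝒫 A → 𝒫 A → Ω
  _≗_ {A} α β = ∀[ x ∶ A ] (α x ⇔ β x)

  _⊆_ : {A : Set} → 𝒫 A → 𝒫 A → Ω
  _⊆_ {A} α β = ∀[ x ∶ A ] (α x ⇒ β x)

  -- The predicate ⟨ u ⟩ determined by a list u.
  elements : {A : Set} → List A → 𝒫 A
  elements u = λ x → ∥ x ∈ u ∥

  _⊂_ : {A : Set} → List A → 𝒫 A → Ω
  _⊂_ {A} u α = ∀[ a ∶ A ] (elements u a ⇒ α a)

  ⟨_⟩ : {A : Set} → 𝒫 (List A) → 𝒫 (𝒫 A)
  ⟨_⟩ {A} T = λ α → ∀[ u ∶ List A ] (u ⊂ α ⇒ T u)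

  ⌊_⌋ : {A : Set} → 𝒫 (𝒫 A) → 𝒫 (List A)
  ⌊ P ⌋ = λ u → P (elements u)

  -- Knaster–Tarski: the union of all post-fixed points.  gfp-post,
  -- gfp-pre and gfp-greatest show that, for monotone φ, it is the greatest
  -- fixed point.
  gfp : {A : Set} → (𝒫 A → 𝒫 A) → 𝒫 A
  gfp {A} φ = λ a → ∃[ X ∶ 𝒫 A ] (X ⊆ φ X ∧ X a)

  Monotone : {A : Set} → (𝒫 A → 𝒫 A) → Set
  Monotone φ = ∀ X Y → Pf (X ⊆ Y) → Pf (φ X ⊆ φ Y)

  ⊆-elim : {A : Set} {α β : 𝒫 A} → Pf (α ⊆ β) → ∀ {x} → Pf (α x) → Pf (β x)
  ⊆-elim h {x} p = ⇒-elim (All-elim h x) p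

  ⊆-intro : {A : Set} {α β : 𝒫 A} → (∀ x → Pf (α x) → Pf (β x)) → Pf (α ⊆ β)
  ⊆-intro h = intro λ x → intro (h x)

  gfp-greatest : {A : Set} (φ : 𝒫 A → 𝒫 A) (X : 𝒫 A) →
                 Pf (X ⊆ φ X) → Pf (X ⊆ gfp φ)
  gfp-greatest φ X X⊆φX =
    ⊆-intro λ a Xa → intro (X , intro (X⊆φX , Xa))

  gfp-post : {A : Set} (φ : 𝒫 A → 𝒫 A) → Monotone φ → Pf (gfp φ ⊆ φ (gfp φ))
  gfp-post φ mono = ⊆-intro λ a → elim λ (X , h) → elim (λ (X⊆φX , Xa) →
    ⊆-elim (mono X (gfp φ) (gfp-greatest φ X X⊆φX)) (⊆-elim X⊆φX Xa)) h

  gfp-pre : {A : Set} (φ : 𝒫 A → 𝒫 A) → Monotone φ → Pf (φ (gfp φ) ⊆ gfp φ)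
  gfp-pre φ mono =
    gfp-greatest φ (φ (gfp φ)) (mono (gfp φ) (φ (gfp φ)) (gfp-post φ mono))

  module _ (A B : Set) where

    graph : (A → B) → 𝒫 (A × B)
    graph f = λ (a , b) → f a ≐ b

    approx : 𝒫 (List (A × B)) → 𝒫 (List (A × B)) → 𝒫 (List (A × B))
    approx T X = λ u →
      ⌊ ⟨ T ⟩ ⌋ u ∧
      (∀[ a ∶ A ] (¬ (∃[ b ∶ B ] elements u (a , b)) ⇒
                   (∃[ b ∶ B ] X (u ∷ʳ (a , b)))))

    approx-monotone : ∀ T → Monotone (approx T)
    approx-monotone T X Y X⊆Y = ⊆-intro λ u → elim λ (u∈ , ext) →
      intro (u∈ , intro λ a → intro λ a∉u →
        elim (λ (b , x) → intro (b , ⊆-elim X⊆Y x))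
             (⇒-elim (All-elim ext a) a∉u))

    Approximable : 𝒫 (List (A × B)) → Ω
    Approximable T = gfp (approx T) []

    HasChoiceFunction : 𝒫 (List (A × B)) → Ω
    HasChoiceFunction T =
      ∃[ f ∶ (A → B) ] (∀[ u ∶ List (A × B) ] (u ⊂ graph f ⇒ T u))

    GDC : 𝒫 (List (A × B)) → Ω
    GDC T = Approximable T ⇒ HasChoiceFunction T

    dom : (A → Maybe B) → 𝒫 A
    dom f = λ a → ¬ (f a ≐ nothing)

    pgraph : (A → Maybe B) → 𝒫 (A × B)
    pgraph f = λ (a , b) → f a ≐ just b

    -- The smaller function is the one with the larger domain.
    _≺_ : (A → Maybe B) → (A → Maybe B) → Ω
    g ≺ f =
      ∃[ a ∶ A ] (¬ dom f a ∧
                  dom g ≗ (λ x → dom f x ∨ x ≐ a) ∧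
                  (∀[ x ∶ A ] (dom f x ⇒ f x ≐ g x)))

    MaxDpf : 𝒫 (𝒫 (A × B)) → 𝒫 (A → Maybe B)
    MaxDpf P = λ f →
      P (pgraph f) ∧ (∀[ g ∶ (A → Maybe B) ] (g ≺ f ⇒ ¬ P (pgraph g)))

    ∃MPCF : 𝒫 (List (A × B)) → Ω
    ∃MPCF T =
      (∃[ α ∶ 𝒫 (A × B) ] ⟨ T ⟩ α) ⇒ (∃[ f ∶ (A → Maybe B) ] MaxDpf ⟨ T ⟩ f)

{-# OPTIONS --safe #-}
-- Call g : ℕ → Maybe B greedy at n if its restriction to {0,…,n} satisfies T
-- and g n is defined whenever some value at n would extend the restriction of
-- g to {0,…,n-1} consistently.  By excluded middle every greedy initial segment
-- can be prolonged, so the finite parts of greedy initial segments form an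
-- approximable predicate on lists over ℕ × Maybe B.  A choice function for this
-- predicate is a function ℕ → Maybe B which is greedy everywhere, and such a
-- function is a maximal partial choice function: a consistent extension at a
-- would contradict greediness at a.
module Submission where

open import Defs
open import Data.Nat using (ℕ; zero; suc; _+_; _<_; s≤s; s≤s⁻¹)
open import Data.Nat.Properties
  using (≤-refl; ≤-trans; <-trans; <-irrefl; n<1+n; m≤m+n; m≤n+m; m≤n⇒m<n∨m≡n; _≟_)
open import Data.List using (List; []; _∷ʳ_; map; upTo)
open import Data.List.Extrema.Nat using (max; xs≤max)
open import Data.List.Membership.Propositional using (_∈_)
open import Data.List.Membership.Propositional.Properties
  using (∈-map⁺; ∈-map⁻; ∈-++⁻; ∈-upTo⁺)
open import Data.List.Relation.Unary.All using (lookup)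
open import Data.List.Relation.Unary.Any using (here)
open import Data.Maybe using (Maybe; just; nothing)
open import Data.Product using (Σ; ∃; _×_; _,_; proj₁)
open import Data.Sum using (inj₁; inj₂)
open import Function using (case_of_)
open import Relation.Nullary using (yes; no; contradiction)
open import Relation.Binary.PropositionalEquality using (_≡_; refl; sym; trans)

keys-bounded : {B : Set} (u : List (ℕ × B)) →
               ∃ λ n → ∀ {p} → p ∈ u → proj₁ p < n
keys-bounded u =
  suc (max 0 (map proj₁ u)) ,
  λ p∈u → s≤s (lookup (xs≤max 0 (map proj₁ u)) (∈-map⁺ proj₁ p∈u))

module _ (𝕃 : Propositions) where

  open Logic 𝕃

  ⊥-elimΩ : {P : Ω} → Pf ⊥ → Pf P
  ⊥-elimΩ = elim λ ()

  ⟨⟩-antitone : {A : Set} {T : 𝒫 (List A)} {α β : 𝒫 A} →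
                (∀ x → Pf (α x) → Pf (β x)) → Pf (⟨ T ⟩ β) → Pf (⟨ T ⟩ α)
  ⟨⟩-antitone α⊆β Tβ = intro λ u → intro λ u⊂α →
    ⇒-elim (All-elim Tβ u) (⊆-intro λ x x∈u → α⊆β x (⊆-elim u⊂α x∈u))

  segment : {C : Set} → (ℕ → C) → ℕ → 𝒫 (ℕ × C)
  segment g n (k , c) = ∥ k < n × g k ≡ c ∥

  just-dom : {B : Set} {f : ℕ → Maybe B} {a : ℕ} {b : B} →
             f a ≡ just b → Pf (dom ℕ B f a)
  just-dom fa≡b = intro (elim λ fa≡⊥ → contra (trans (sym fa≡b) fa≡⊥))
    where
    contra : {B : Set} {b : B} → just b ≡ nothing → Pf ⊥
    contra ()

  -- Equality is squashed because it only ever arrives inside `Pf`: from the clause `f x ≐ g x` of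
  -- `≺` or from membership in a `segment`.
  Agree : {C : Set} → (ℕ → C) → (ℕ → C) → ℕ → Set
  Agree g h n = ∀ k → k < n → Pf (g k ≐ h k)

  agree-refl : {C : Set} {g : ℕ → C} {n : ℕ} → Agree g g n
  agree-refl k _ = intro refl

  ≐-trans : {C : Set} {x y z : C} → Pf (x ≐ y) → Pf (y ≐ z) → Pf (x ≐ z)
  ≐-trans p q = elim (λ x≡y → elim (λ y≡z → intro (trans x≡y y≡z)) q) p

  update : {C : Set} → (ℕ → C) → ℕ → C → ℕ → C
  update g n c k with k ≟ n
  ... | yes _ = c
  ... | no  _ = g k

  update-same : {C : Set} (g : ℕ → C) (n : ℕ) {c : C} → update g n c n ≡ c
  update-same g n with n ≟ n
  ... | yes _   = refl
  ... | no  n≢n = contradiction refl n≢n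

  update-below : {C : Set} (g : ℕ → C) {n k : ℕ} {c : C} →
                 k < n → g k ≡ update g n c k
  update-below g {n} {k} k<n with k ≟ n
  ... | yes k≡n = contradiction k<n (<-irrefl k≡n)
  ... | no  _   = refl

  module _ {B : Set} (T : 𝒫 (List (ℕ × B))) where

    -- Undefined arguments drop out here, whereas `segment g n` records them as pairs with value
    -- `nothing`.
    restrict : (ℕ → Maybe B) → ℕ → 𝒫 (ℕ × B)
    restrict g n (k , b) = segment g n (k , just b)

    Consistent : (ℕ → Maybe B) → ℕ → Ω
    Consistent g n = ⟨ T ⟩ (restrict g n)

    -- The rivals `h` are whole functions rather than values at `n`, so that any `g ≺ f` can be
    -- plugged in directly.
    Greedy : (ℕ → Maybe B) → ℕ → Ω
    Greedy g n = ∥ Pf (Consistent g (suc n)) ×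
                   (∀ h → Agree g h n → Pf (dom ℕ B h n) →
                    Pf (Consistent h (suc n)) → Pf (dom ℕ B g n)) ∥

    GreedyBelow : (ℕ → Maybe B) → ℕ → Set
    GreedyBelow g n = ∀ k → k < n → Pf (Greedy g k)

    consistent-agree : ∀ {g h n} → Agree g h n →
                       Pf (Consistent g n) → Pf (Consistent h n)
    consistent-agree g~h = ⟨⟩-antitone λ (k , b) → elim λ (k<n , hk≡b) →
      elim (λ gk≡hk → intro (k<n , trans gk≡hk hk≡b)) (g~h k k<n)

    -- Greediness at `n` depends only on the values at `0` to `n`, and every rival of `h` at `n` is
    -- also a rival of `g`.
    greedy-agree : ∀ {g h n} → Agree g h (suc n) →
                   Pf (Greedy g n) → Pf (Greedy h n)
    greedy-agree {n = n} g~h = elim λ (con , grd) → intro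
      ( consistent-agree g~h con
      , λ j h~j jn con-j → intro λ hn≐⊥ → ⇒-elim
          (grd j (λ k k<n → ≐-trans (g~h k (<-trans k<n (n<1+n n))) (h~j k k<n))
             jn con-j)
          (≐-trans (g~h n ≤-refl) hn≐⊥))

    greedyBelow-agree : ∀ {g h n} → Agree g h n →
                        GreedyBelow g n → GreedyBelow h n
    greedyBelow-agree g~h grd k k<n =
      greedy-agree (λ j j<1+k → g~h j (≤-trans j<1+k k<n)) (grd k k<n)

    greedyBelow-snoc : ∀ {g n} → GreedyBelow g n → Pf (Greedy g n) →
                       GreedyBelow g (suc n)
    greedyBelow-snoc below at k k<1+n with m≤n⇒m<n∨m≡n (s≤s⁻¹ k<1+n)
    ... | inj₁ k<n  = below k k<n
    ... | inj₂ refl = at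

    -- The only point that `g` can add to the domain of `f` is `a`, which `k < a` rules out.
    ≺⇒agree : ∀ {f g a} → Pf (dom ℕ B g ≗ (λ x → dom ℕ B f x ∨ x ≐ a)) →
              Pf (∀[ x ∶ ℕ ] (dom ℕ B f x ⇒ f x ≐ g x)) → Agree f g a
    ≺⇒agree {f} {g} dom-g f⊆g k k<a with f k in fk | g k in gk
    ... | nothing | nothing = intro refl
    ... | nothing | just _  = ⊥-elimΩ (elim (λ (fwd , _) → elim
      (λ { (inj₁ fk∈) → ⇒-elim fk∈ (intro fk)
         ; (inj₂ k≐a) → elim (λ k≡a → contradiction k<a (<-irrefl k≡a)) k≐a })
      (⇒-elim fwd (just-dom {f = g} gk))) (All-elim dom-g k))
    ... | just _  | _       =
      elim (λ fk≡gk → intro (trans (sym fk) (trans fk≡gk gk)))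
        (⇒-elim (All-elim f⊆g k) (just-dom {f = f} fk))

    Prolongation : (ℕ → Maybe B) → ℕ → ℕ → Ω
    Prolongation g n m = ∥ (Σ (ℕ → Maybe B) λ h → Agree g h n × GreedyBelow h m) ∥

    -- Containment in the segment, rather than equality with it, makes the predicate pass to every
    -- list with elements in `u`.
    GreedyPart : 𝒫 (List (ℕ × Maybe B))
    GreedyPart u = ∥ (Σ (ℕ → Maybe B) λ g → Σ ℕ λ n →
                      GreedyBelow g n × Pf (u ⊂ segment g n)) ∥

    greedyPart-consistent : ∀ {u} → Pf (GreedyPart u) →
                            Pf (⌊ ⟨ GreedyPart ⟩ ⌋ u)
    greedyPart-consistent = elim λ (g , n , grd , u⊂g) →
      intro λ v → intro λ v⊂u → intro
        (g , n , grd , ⊆-intro λ x x∈v → ⊆-elim u⊂g (⊆-elim v⊂u x∈v))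

    choice⇒greedy : ∀ {f} →
      Pf (∀[ u ∶ List (ℕ × Maybe B) ] (u ⊂ graph ℕ (Maybe B) f ⇒ GreedyPart u)) →
      ∀ n → Pf (Greedy f n)
    choice⇒greedy {f} choice n = elim
      (λ (g , m , grd , u⊂g) →
        let in-g : ∀ {k} → k < suc n → Pf (segment g m (k , f k))
            in-g k<1+n = ⊆-elim u⊂g (intro (∈-map⁺ pair (∈-upTo⁺ k<1+n)))
        -- The pair `(n , f n)` lies in the segment of length `m`, which forces `n < m`, so `g` is
        -- known to be greedy at `n`.
        in elim
          (λ (n<m , _) → greedy-agree
            (λ k k<1+n → elim (λ (_ , gk≡fk) → intro gk≡fk) (in-g k<1+n))
            (grd n n<m))
          (in-g ≤-refl))
      (⇒-elim (All-elim choice u) (⊆-intro λ _ → elim λ p∈u → in-graph p∈u))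
      where
      pair : ℕ → ℕ × Maybe B
      pair k = k , f k
      u : List (ℕ × Maybe B)
      u = map pair (upTo (suc n))
      in-graph : ∀ {p} → p ∈ u → Pf (graph ℕ (Maybe B) f p)
      in-graph p∈u with _ , _ , refl ← ∈-map⁻ pair p∈u = intro refl

    module _ {α : 𝒫 (ℕ × B)} (Tα : Pf (⟨ T ⟩ α)) where

      -- Greediness at the last argument contains the claim; the empty segment lies inside `α`,
      -- whence the need for some `α` in `⟨ T ⟩`.
      greedyBelow⇒consistent : ∀ {g} n → GreedyBelow g n → Pf (Consistent g n)
      greedyBelow⇒consistent zero    _   = ⟨⟩-antitone (λ _ → elim λ ()) Tα
      greedyBelow⇒consistent (suc n) grd = elim proj₁ (grd n ≤-refl)

      -- Membership in `⟨ T ⟩` is tested on finite lists, and each list in the graph of `f` fits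
      -- into one initial segment.
      greedy⇒consistent : ∀ {f} → (∀ n → Pf (Greedy f n)) →
                          Pf (⟨ T ⟩ (pgraph ℕ B f))
      greedy⇒consistent {f} grd = intro λ u → intro λ u⊂f →
        let n , bound = keys-bounded u in
        ⇒-elim (All-elim (greedyBelow⇒consistent n λ k _ → grd k) u)
          (⊆-intro λ p → elim λ p∈u →
            elim (λ fk≡b → intro (bound p∈u , fk≡b)) (⊆-elim u⊂f (intro p∈u)))

      greedy⇒maximal : ∀ {f} → (∀ n → Pf (Greedy f n)) →
                       Pf (MaxDpf ℕ B ⟨ T ⟩ f)
      greedy⇒maximal {f} grd = intro (greedy⇒consistent grd , intro λ g → intro
        (elim λ (a , h) → elim (λ (a∉f , h) → elim (λ (dom-g , f⊆g) →
          intro λ Tg → ⇒-elim a∉f (elim (λ (_ , grd-a) →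
            grd-a g (≺⇒agree dom-g f⊆g)
              (elim (λ (_ , bwd) → ⇒-elim bwd (intro (inj₂ (intro refl))))
                (All-elim dom-g a))
              (⟨⟩-antitone (λ _ → elim λ (_ , gk≡b) → intro gk≡b) Tg))
            (grd a))) h) h))

      -- Either some rival is defined at `n` and serves as the prolongation, or none is and the
      -- value `nothing` is greedy. The squashed conclusion allows a rival to be used without a
      -- choice principle.
      prolong : ExcludedMiddle → ∀ {g} n → GreedyBelow g n →
                Pf (Prolongation g n (suc n))
      prolong em {g} n grd = elim
        (λ { (inj₁ ext) → elim (λ (h , g~h , hn , con) → intro
               (h , g~h , greedyBelow-snoc (greedyBelow-agree g~h grd)
                            (intro (con , λ _ _ _ _ → hn)))) ext
           ; (inj₂ ¬ext) → intro
               (g₀ , g~g₀ , greedyBelow-snoc (greedyBelow-agree g~g₀ grd)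
                 (intro (con₀ , λ h g₀~h hn con → ⊥-elimΩ (⇒-elim ¬ext (intro
                   (h , (λ k k<n → ≐-trans (g~g₀ k k<n) (g₀~h k k<n)) , hn , con)))))) })
        (em Extension)
        where
        Extension : Ω
        Extension = ∥ (Σ (ℕ → Maybe B) λ h → Agree g h n × Pf (dom ℕ B h n) ×
                       Pf (Consistent h (suc n))) ∥
        g₀ : ℕ → Maybe B
        g₀ = update g n nothing
        g~g₀ : Agree g g₀ n
        g~g₀ k k<n = intro (update-below g k<n)
        restrict-g₀ : ∀ k {b} → k < suc n → g₀ k ≡ just b →
                      k < n × g k ≡ just b
        restrict-g₀ k k<1+n g₀k≡b with m≤n⇒m<n∨m≡n (s≤s⁻¹ k<1+n)
        ... | inj₁ k<n = k<n , trans (update-below g k<n) g₀k≡b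
        ... | inj₂ refl with () ← trans (sym (update-same g n)) g₀k≡b
        -- The value `nothing` at `n` adds no pair, so consistency is inherited from the segment of
        -- length `n`.
        con₀ : Pf (Consistent g₀ (suc n))
        con₀ = ⟨⟩-antitone
          (λ (k , b) → elim λ (k<1+n , g₀k≡b) → intro (restrict-g₀ k k<1+n g₀k≡b))
          (greedyBelow⇒consistent n grd)

      prolong-by : ExcludedMiddle → ∀ {g n} d → GreedyBelow g n →
                   Pf (Prolongation g n (d + n))
      prolong-by em {g} zero grd = intro (g , agree-refl , grd)
      prolong-by em {n = n} (suc d) grd = elim
        (λ (h , g~h , grd-h) → elim
          (λ (j , h~j , grd-j) → intro
            (j , (λ k k<n → ≐-trans (g~h k k<n) (h~j k (≤-trans k<n (m≤n+m n d))))
               , grd-j))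
          (prolong em (d + n) grd-h))
        (prolong-by em d grd)

      greedyPart-extend : ExcludedMiddle → ∀ u a → Pf (GreedyPart u) →
                          Pf (∃[ c ∶ Maybe B ] GreedyPart (u ∷ʳ (a , c)))
      greedyPart-extend em u a = elim λ (g , n , grd , u⊂g) → elim
        (λ (h , g~h , grd-h) →
          let in-h : ∀ {p} → p ∈ u ∷ʳ (a , h a) → Pf (segment h (suc a + n) p)
              in-h p∈ = case ∈-++⁻ u p∈ of λ
                { (inj₁ p∈u) → elim
                    (λ (k<n , gk≡c) → elim
                      (λ gk≡hk → intro ( ≤-trans k<n (m≤n+m n (suc a))
                                       , trans (sym gk≡hk) gk≡c))
                      (g~h _ k<n))
                    (⊆-elim u⊂g (intro p∈u))
                ; (inj₂ (here refl)) → intro (m≤m+n (suc a) n , refl) }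
          in intro (h a , intro
               (h , suc a + n , grd-h , ⊆-intro λ _ → elim in-h)))
        -- The length `suc a + n` exceeds `a` and is at least `n`, so the new segment contains both
        -- the pair at `a` and all of `u`.
        (prolong-by em (suc a) grd)

      -- By coinduction: `GreedyPart` is itself a post-fixed point, and it contains the empty list.
      greedyPart-approximable : ExcludedMiddle →
                                Pf (Approximable ℕ (Maybe B) GreedyPart)
      greedyPart-approximable em = ⊆-elim
        (gfp-greatest (approx ℕ (Maybe B) GreedyPart) GreedyPart (⊆-intro λ u part →
          intro (greedyPart-consistent part , intro λ a → intro λ _ →
            greedyPart-extend em u a part)))
        (intro ((λ _ → nothing) , 0 , (λ _ ()) , ⊆-intro λ _ → elim λ ()))

theorem31 : (𝕃 : Propositions) → let open Logic 𝕃 in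
    ExcludedMiddle →
    ((B : Set) (T : 𝒫 (List (ℕ × B))) → Pf (GDC ℕ B T)) →
    (B : Set) (T : 𝒫 (List (ℕ × B))) → Pf (∃MPCF ℕ B T)
theorem31 𝕃 em gdc B T = intro (elim λ (α , Tα) → elim
    (λ (f , choice) → intro (f , greedy⇒maximal 𝕃 T Tα (choice⇒greedy 𝕃 T choice)))
    -- With codomain `Maybe B`, being undefined counts as a value, so a total choice function is
    -- already a decidable partial function.
    (⇒-elim (gdc (Maybe B) (GreedyPart 𝕃 T)) (greedyPart-approximable 𝕃 T Tα em)))
  where open Logic 𝕃
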